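{- For every integer $n\ge 1$ there is a bijection $\beta:\mathcal{SM}(n)\to\mathcal{B}(n)$ such that, for all integers $k,p\ge 0$, $\beta$ restricts to a bijection between $\mathcal{SM}(n,k,p)$ and $\mathcal{B}(n,k,p)$.
   Context: All matrices are square (of dimension at least $1$) with nonnegative integer entries; the dimension of a matrix is its number of rows, and rows and columns are numbered starting from $1$ (top to bottom, left to right). The size of a matrix is the sum of all its entries; the sum of a row (column) is the sum of the entries in it. In a matrix of dimension $m$, a cell $(i,j)$ is an SE-cell if $i+j>m+1$. A super triangular matrix is an upper-triangular matrix all of whose SE-cells are zero. For $r\ge 0$, $\mathcal{SM}_r(n)$ is the set of super triangular matrices of size $n$ and dimension $2r+1$ such that: (a) for each $1\le i\le r$, column $i$ contains a nonzero entry; (b) for each $1\le i\le r$, row $r+1-i$ or column $r+1+i$ (or both) contains a nonzero entry. Put $\mathcal{SM}(n)=\bigcup_{r\ge 0}\mathcal{SM}_r(n)$. The center column of a matrix of dimension $2r+1$ is column $r+1$. $\mathcal{SM}(n,k,p)$ is the set of matrices in $\mathcal{SM}(n)$ whose first row has sum $k$ and whose center column has sum $p$. $\mathcal{B}(n)$ is the set of upper-triangular matrices of nonnegative integers of size $n$ in which every row other than the first contains a nonzero entry (the first row may be zero or nonzero). $\mathcal{B}(n,k,p)$ is the set of matrices in $\mathcal{B}(n)$ whose first row has sum $p$ and whose last column has sum $k$. -}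

module Defs where

open import Data.Fin.Base using (Fin; zero; toℕ; fromℕ)
open import Data.Nat.Base using (ℕ; suc; _+_; _*_; _∸_; _≤_; _>_)
open import Data.Product.Base using (∃; Σ-syntax; _×_; _,_; proj₁)
open import Data.Sum.Base using (_⊎_)
open import Data.Vec.Base using (Vec; lookup; map; sum)
open import Function.Bundles using (Bijection)
open import Level using (0ℓ)
open import Relation.Binary.Bundles using (Setoid)
open import Relation.Binary.PropositionalEquality using (_≡_; _≢_; setoid)
import Relation.Binary.Construct.On as On
open import Relation.Unary using (Pred; ⋃)

-- (d , M) is a matrix of dimension suc d, given as the vector of its rows.
SqMatrix : Set
SqMatrix = Σ[ d ∈ ℕ ] Vec (Vec ℕ (suc d)) (suc d)

dim : SqMatrix → ℕ
dim (d , _) = suc d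

Index : SqMatrix → Set
Index A = Fin (dim A)

first last : (A : SqMatrix) → Index A
first _       = zero
last  (d , _) = fromℕ d

-- Rows and columns are numbered from 1, whereas toℕ counts from 0.
number : ∀ {m} → Fin m → ℕ
number i = suc (toℕ i)

entry : (A : SqMatrix) → Index A → Index A → ℕ
entry (_ , M) i j = lookup (lookup M i) j

rowSum colSum : (A : SqMatrix) → Index A → ℕ
rowSum (_ , M) i = sum (lookup M i)
colSum (_ , M) j = sum (map (λ row → lookup row j) M)

size : SqMatrix → ℕ
size (_ , M) = sum (map sum M)

NonzeroRow NonzeroColumn : SqMatrix → Pred ℕ 0ℓ
NonzeroRow    A c = Σ[ i ∈ Index A ] number i ≡ c × (Σ[ j ∈ Index A ] entry A i j ≢ 0)
NonzeroColumn A c = Σ[ j ∈ Index A ] number j ≡ c × (Σ[ i ∈ Index A ] entry A i j ≢ 0)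

UpperTriangular : Pred SqMatrix 0ℓ
UpperTriangular A = ∀ (i j : Index A) → number i > number j → entry A i j ≡ 0

SECell : (A : SqMatrix) → Index A → Index A → Set
SECell A i j = number i + number j > dim A + 1

SuperTriangular : Pred SqMatrix 0ℓ
SuperTriangular A =
  UpperTriangular A × (∀ (i j : Index A) → SECell A i j → entry A i j ≡ 0)

SMᵣ : ℕ → ℕ → Pred SqMatrix 0ℓ
SMᵣ r n A =
    SuperTriangular A
  × size A ≡ n
  × dim A ≡ 2 * r + 1
  × (∀ i → 1 ≤ i → i ≤ r → NonzeroColumn A i)
  × (∀ i → 1 ≤ i → i ≤ r → NonzeroRow A (r + 1 ∸ i) ⊎ NonzeroColumn A (r + 1 + i))

SM : ℕ → Pred SqMatrix 0ℓ
SM n = ⋃ ℕ (λ r → SMᵣ r n)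

IsCenter : (A : SqMatrix) → Pred (Index A) 0ℓ
IsCenter A j = Σ[ r ∈ ℕ ] dim A ≡ 2 * r + 1 × number j ≡ r + 1

SM′ : ℕ → ℕ → ℕ → Pred SqMatrix 0ℓ
SM′ n k p A =
    SM n A
  × rowSum A (first A) ≡ k
  × (Σ[ j ∈ Index A ] IsCenter A j × colSum A j ≡ p)

B : ℕ → Pred SqMatrix 0ℓ
B n A =
    UpperTriangular A
  × size A ≡ n
  × (∀ i → 2 ≤ i → i ≤ dim A → NonzeroRow A i)

B′ : ℕ → ℕ → ℕ → Pred SqMatrix 0ℓ
B′ n k p A =
    B n A
  × rowSum A (first A) ≡ p
  × colSum A (last A) ≡ k

-- The subset of matrices satisfying P. Two elements are equal when the
-- matrices are; the membership proofs are ignored.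
⟦_⟧ : Pred SqMatrix 0ℓ → Setoid 0ℓ 0ℓ
⟦ P ⟧ = On.setoid {B = ∃ P} (setoid SqMatrix) proj₁

-- For P′ ⊆ P and Q′ ⊆ Q: some bijection from P′ to Q′ agrees with f on P′.
RestrictsTo : ∀ {P Q} → Bijection ⟦ P ⟧ ⟦ Q ⟧ →
              (P′ Q′ : Pred SqMatrix 0ℓ) → Set
RestrictsTo {P} f P′ Q′ =
  Σ[ g ∈ Bijection ⟦ P′ ⟧ ⟦ Q′ ⟧ ]
    (∀ (x : ∃ P′) (y : ∃ P) → proj₁ x ≡ proj₁ y →
      proj₁ (Bijection.to g x) ≡ proj₁ (Bijection.to f y))

-- Let L_1, …, L_r, C, R_r, …, R_1 be the columns of a matrix in SM_r(n), each cut
-- down to its free cells, so that L_j and R_j have j cells. The rows of its image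
-- in B(n), from the top, are C, R_r, L_r, …, R_1, L_1 read from the bottom up,
-- with the zero columns R_j left out. For these to form a triangle R_j must be
-- one longer than L_j, so when R_j ≠ 0 a zero column is inserted starting there.
-- To invert, remove rows from the top, keeping their sum. When the next row is
-- L_j because R_j = 0, adding it gives the first j entries of
-- L_j + … + L_r + C + R_r + … + R_j, the lowest of which is the sum of row j of
-- the matrix, nonzero by condition (b). When the next row is R_j ≠ 0, the
-- same position holds the inserted zero. Hence this entry decides the case.
module Submission where

open import Data.Empty using (⊥-elim)
open import Data.Nat.Base
open import Data.Nat.Properties
open import Algebra.Properties.CommutativeSemigroup +-commutativeSemigroup using (interchange; x∙yz≈y∙xz)
open import Data.Product.Base using (Σ-syntax; _×_; _,_; proj₁; proj₂)
open import Data.Sum.Base as Sum using (_⊎_; inj₁; inj₂)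
open import Data.Unit.Base using (⊤; tt)
open import Data.Fin.Base as Fin using (Fin; toℕ; fromℕ; fromℕ<)
open import Data.Fin.Properties using (toℕ-injective; toℕ<n; toℕ-fromℕ<)
open import Data.Vec.Base using (Vec; []; _∷_; head; tail; lookup; map; replicate; sum; tabulate; zipWith)
  renaming (last to final)
open import Data.Vec.Properties
open import Defs
open import Relation.Binary.Definitions using (tri<; tri≈; tri>)
open import Relation.Nullary using (¬_; yes; no)
open import Relation.Binary.PropositionalEquality
open import Function.Bundles using (Bijection)
open import Function.Base using (_∘_)

private variable
  m m′ n r r′ : ℕ

-- Column pairs, triangles of rows, and padding with zeros.

infixl 6 _⊕_
_⊕_ : Vec ℕ n → Vec ℕ n → Vec ℕ n
_⊕_ = zipWith _+_

-- In ⟨ R , L ⟩∷ S of type Sides j, L and R stand for L_j and R_j. Here and in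
-- the centre column entries run from the bottom up.
data Sides : ℕ → Set where
  []      : Sides 0
  ⟨_,_⟩∷_ : Vec ℕ (suc r) → Vec ℕ (suc r) → Sides r → Sides (suc r)

data Triangle : ℕ → Set where
  []  : Triangle 0
  _∷_ : Vec ℕ (suc n) → Triangle n → Triangle (suc n)

-- Each `skip` is an inserted zero column. Vectors have one cell more than the indices count: `base`
-- always keeps the last cell, which is the first-row entry of a column.
data Padding : ℕ → ℕ → Set where
  base : Padding 0 0
  keep : Padding r m → Padding (suc r) (suc m)
  skip : Padding r m → Padding r (suc m)

pad : Padding r m → Vec ℕ (suc r) → Vec ℕ (suc m)
pad base     v       = v
pad (keep θ) (x ∷ v) = x ∷ pad θ v
pad (skip θ) v       = 0 ∷ pad θ v

pad-injective : (θ : Padding r m) {v w : Vec ℕ (suc r)} → pad θ v ≡ pad θ w → v ≡ w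
pad-injective base     e = e
pad-injective (keep θ) {x ∷ v} {y ∷ w} e =
  cong₂ _∷_ (∷-injectiveˡ e) (pad-injective θ (∷-injectiveʳ e))
pad-injective (skip θ) e = pad-injective θ (∷-injectiveʳ e)

sum-pad : (θ : Padding r m) (v : Vec ℕ (suc r)) → sum (pad θ v) ≡ sum v
sum-pad base     v       = refl
sum-pad (keep θ) (x ∷ v) = cong (x +_) (sum-pad θ v)
sum-pad (skip θ) v       = sum-pad θ v

final-∷ : ∀ x (v : Vec ℕ (suc n)) → final (x ∷ v) ≡ final v
final-∷ x (y ∷ v) = refl

final-pad : (θ : Padding r m) (v : Vec ℕ (suc r)) → final (pad θ v) ≡ final v
final-pad base     v           = refl
final-pad (keep θ) (x ∷ y ∷ v) = trans (final-∷ x (pad θ (y ∷ v))) (final-pad θ (y ∷ v))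
final-pad (skip θ) v           = trans (final-∷ 0 (pad θ v)) (final-pad θ v)

pad-⊕ : (θ : Padding r m) (v w : Vec ℕ (suc r)) → pad θ (v ⊕ w) ≡ pad θ v ⊕ pad θ w
pad-⊕ base     v       w       = refl
pad-⊕ (keep θ) (x ∷ v) (y ∷ w) = cong (x + y ∷_) (pad-⊕ θ v w)
pad-⊕ (skip θ) v       w       = cong (0 ∷_) (pad-⊕ θ v w)

-- A zero sum of naturals has zero summands, so both summands vanish wherever `θ` inserts a zero.
-- This lets decoding recover separate columns when only their sum is known to be padded.
pad-⊕⁻¹ : (θ : Padding r m) {x : Vec ℕ (suc r)} (v w : Vec ℕ (suc m)) → pad θ x ≡ v ⊕ w →
          Σ[ v′ ∈ Vec ℕ (suc r) ] Σ[ w′ ∈ Vec ℕ (suc r) ]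
            pad θ v′ ≡ v × pad θ w′ ≡ w × v′ ⊕ w′ ≡ x
pad-⊕⁻¹ base     v w e = v , w , refl , refl , sym e
pad-⊕⁻¹ (keep θ) {x ∷ xs} (a ∷ v) (b ∷ w) e
  with v′ , w′ , refl , refl , refl ← pad-⊕⁻¹ θ v w (∷-injectiveʳ e) =
  a ∷ v′ , b ∷ w′ , refl , refl , cong (_∷ _) (sym (∷-injectiveˡ e))
pad-⊕⁻¹ (skip θ) (a ∷ v) (b ∷ w) e
  with v′ , w′ , refl , refl , refl ← pad-⊕⁻¹ θ v w (∷-injectiveʳ e) =
  v′ , w′
  , cong (_∷ _) (sym (m+n≡0⇒m≡0 a (sym (∷-injectiveˡ e))))
  , cong (_∷ _) (sym (m+n≡0⇒n≡0 a (sym (∷-injectiveˡ e))))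
  , refl

-- Zero vectors and the encoding relation.

sum≡0⇒≡zeros : (v : Vec ℕ n) → sum v ≡ 0 → v ≡ replicate n 0
sum≡0⇒≡zeros []          e = refl
sum≡0⇒≡zeros (zero  ∷ v) e = cong (0 ∷_) (sum≡0⇒≡zeros v e)

sum-zeros : ∀ n → sum (replicate n 0) ≡ 0
sum-zeros zero    = refl
sum-zeros (suc n) = sum-zeros n

final-zeros : ∀ n → final (replicate (suc n) 0) ≡ 0
final-zeros zero    = refl
final-zeros (suc n) = final-zeros n

⊕-zeros : (v : Vec ℕ n) → v ⊕ replicate n 0 ≡ v
⊕-zeros []      = refl
⊕-zeros (x ∷ v) = cong₂ _∷_ (+-identityʳ x) (⊕-zeros v)

-- The rows are built from the outermost pair inwards, that is, from the bottom row up. The padding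
-- records the zero columns inserted so far; every later row has to respect them.
data Encodes : Sides r → Triangle m → Padding r m → Set where
  base   : Encodes [] [] base
  single : ∀ {S : Sides r} {T : Triangle m} {θ} (L : Vec ℕ (suc r)) → Encodes S T θ →
           Encodes (⟨ replicate (suc r) 0 , L ⟩∷ S) (pad θ L ∷ T) (keep θ)
  -- `R` and `L` are equally long, but consecutive rows of a triangle differ by one cell. The
  -- leading 0 makes up the difference, and `skip` continues that zero column through all rows added
  -- above.
  double : ∀ {S : Sides r} {T : Triangle m} {θ} (R L : Vec ℕ (suc r)) → sum R ≢ 0 → Encodes S T θ →
           Encodes (⟨ R , L ⟩∷ S) ((0 ∷ pad θ R) ∷ (pad θ L ∷ T)) (keep (skip θ))

Encoding : Sides r → Set
Encoding {r} S = Σ[ m ∈ ℕ ] Σ[ T ∈ Triangle m ] Σ[ θ ∈ Padding r m ] Encodes S T θ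

encode : (S : Sides r) → Encoding S
encode [] = 0 , [] , base , base
encode (⟨ R , L ⟩∷ S) with sum R ≟ 0 | encode S
... | yes R≡0 | m , T , θ , e rewrite sum≡0⇒≡zeros R R≡0 = _ , _ , _ , single L e
... | no  R≢0 | m , T , θ , e = _ , _ , _ , double R L R≢0 e

-- The constructors exclude each other, since `double` demands a nonzero `R`.
Encodes-functional : ∀ {S : Sides r} {T : Triangle m} {T′ : Triangle m′} {θ θ′} →
  Encodes S T θ → Encodes S T′ θ′ →
  _≡_ {A = Σ[ m ∈ ℕ ] Triangle m × Padding r m} (m , T , θ) (m′ , T′ , θ′)
Encodes-functional base base = refl
Encodes-functional (single L e) (single _ e′) with refl ← Encodes-functional e e′ = refl
Encodes-functional {r = suc r} (single L e) (double _ _ R≢0 e′) = ⊥-elim (R≢0 (sum-zeros r))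
Encodes-functional {r = suc r} (double _ _ R≢0 e) (single _ e′) = ⊥-elim (R≢0 (sum-zeros r))
Encodes-functional (double R L _ e) (double _ _ _ e′) with refl ← Encodes-functional e e′ = refl

-- A padding that arises from `Encodes` never begins with `skip`: each `skip` sits directly under a
-- `keep`.
head-pad : ∀ {S : Sides r} {T : Triangle m} {θ} → Encodes S T θ →
           ∀ v → head (pad θ v) ≡ head v
head-pad base             v       = refl
head-pad (single _ _)     (x ∷ v) = refl
head-pad (double _ _ _ _) (x ∷ v) = refl

-- Conditions (a) and (b): the head of c ⊕ L ⊕ R is the sum of row j, because the
-- outer columns have already been merged into c.
Valid : Vec ℕ (suc r) → Sides r → Set
Valid _       []             = ⊤
Valid (_ ∷ c) (⟨ R , L ⟩∷ S) =
  sum L ≢ 0 × (sum R ≢ 0 ⊎ head (c ⊕ L ⊕ R) ≢ 0) × Valid (c ⊕ L ⊕ R) S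

-- Decoding from the top: uniqueness and existence.

NonzeroRows : Triangle m → Set
NonzeroRows []      = ⊤
NonzeroRows (v ∷ T) = sum v ≢ 0 × NonzeroRows T

-- Each row is a padded `L`, nonzero by (a), or a padded `R`, which gets a row only when it is
-- nonzero.
nonzeroRows : ∀ {S : Sides r} {T : Triangle m} {θ} → Encodes S T θ →
              ∀ c → Valid c S → NonzeroRows T
nonzeroRows base           c       _                  = tt
nonzeroRows {θ = keep θ} (single L e) (_ ∷ c) (L≢0 , _ , v) =
  L≢0 ∘ trans (sym (sum-pad θ L)) , nonzeroRows e _ v
nonzeroRows {θ = keep (skip θ)} (double R L R≢0 e) (_ ∷ c) (L≢0 , _ , v) =
  R≢0 ∘ trans (sym (sum-pad θ R)) , L≢0 ∘ trans (sym (sum-pad θ L)) , nonzeroRows e _ v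

pad-⊕-cong : (θ : Padding r m) (θ′ : Padding r′ m) → ∀ {a b a′ b′} →
             pad θ a ≡ pad θ′ a′ → pad θ b ≡ pad θ′ b′ → pad θ (a ⊕ b) ≡ pad θ′ (a′ ⊕ b′)
pad-⊕-cong θ θ′ {a} {b} {a′} {b′} p q =
  trans (pad-⊕ θ a b) (trans (cong₂ _⊕_ p q) (sym (pad-⊕ θ′ a′ b′)))

pad-zeros : (θ : Padding r m) → pad θ (replicate (suc r) 0) ≡ replicate (suc m) 0
pad-zeros base     = refl
pad-zeros (keep θ) = cong (0 ∷_) (pad-zeros θ)
pad-zeros (skip θ) = cong (0 ∷_) (pad-zeros θ)

-- The equations `p` and `q` are what a competing `double` step would force: a zero in the deciding
-- position of both the running sum and the next row. With `R` zero, that position holds the row sum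
-- which (b) requires to be nonzero.
single≢double : ∀ {S : Sides r} {T : Triangle (suc m)} {θ} → Encodes S T θ →
                ∀ c L {x y : Vec ℕ (suc m)} → pad θ c ≡ 0 ∷ x → pad θ L ≡ 0 ∷ y →
                let R = replicate (suc r) 0 in ¬ (sum R ≢ 0 ⊎ head (c ⊕ L ⊕ R) ≢ 0)
single≢double {r = r} e c L p q (inj₁ z≢0) = z≢0 (sum-zeros r)
single≢double e c@(_ ∷ _) L@(_ ∷ _) p q (inj₂ h≢0) =
  h≢0 (trans (cong head (⊕-zeros (c ⊕ L)))
    (cong₂ _+_ (trans (sym (head-pad e c)) (cong head p))
               (trans (sym (head-pad e L)) (cong head q))))

Triangle-∷-injective : {u v : Vec ℕ (suc n)} {T U : Triangle n} →
                       _≡_ {A = Triangle (suc n)} (u ∷ T) (v ∷ U) → u ≡ v × T ≡ U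
Triangle-∷-injective refl = refl , refl

-- Both encodings are decoded in parallel, with equality of the running sums of removed rows as
-- invariant. The sums are compared in padded form because `θ` and `θ′` are identified only by the
-- recursive call.
Encodes-injective : ∀ {S : Sides r} {S′ : Sides r′} {T T′ : Triangle m} {θ θ′} →
  Encodes S T θ → Encodes S′ T′ θ′ → ∀ c c′ → Valid c S → Valid c′ S′ →
  pad θ c ≡ pad θ′ c′ → T ≡ T′ →
  _≡_ {A = Σ[ r ∈ ℕ ] Sides r × Padding r m} (r , S , θ) (r′ , S′ , θ′)
Encodes-injective base base _ _ _ _ _ _ = refl
Encodes-injective (single {r} {θ = θ} L e) (single {r′} {θ = θ′} L′ e′)
                  (_ ∷ c) (_ ∷ c′) (_ , _ , v) (_ , _ , v′) p t
  with u≡ , T≡ ← Triangle-∷-injective t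
  with refl ← Encodes-injective e e′ _ _ v v′
         (pad-⊕-cong θ θ′ (pad-⊕-cong θ θ′ (∷-injectiveʳ p) u≡)
                     (trans (pad-zeros θ) (sym (pad-zeros θ′)))) T≡
  with refl ← pad-injective θ u≡ = refl
Encodes-injective (single L e) (double R′ L′ _ e′) (_ ∷ c) (_ ∷ c′) (_ , h , _) _ p t =
  ⊥-elim (single≢double e c L (∷-injectiveʳ p) (proj₁ (Triangle-∷-injective t)) h)
Encodes-injective (double R L _ e) (single L′ e′) (_ ∷ c) (_ ∷ c′) _ (_ , h , _) p t =
  ⊥-elim (single≢double e′ c′ L′ (sym (∷-injectiveʳ p)) (sym (proj₁ (Triangle-∷-injective t))) h)
Encodes-injective (double {θ = θ} R L _ e) (double {θ = θ′} R′ L′ _ e′)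
                  (_ ∷ c) (_ ∷ c′) (_ , _ , v) (_ , _ , v′) p t
  with R≡ , t′ ← Triangle-∷-injective t
  with L≡ , T≡ ← Triangle-∷-injective t′
  with refl ← Encodes-injective e e′ _ _ v v′
         (pad-⊕-cong θ θ′ (pad-⊕-cong θ θ′ (∷-injectiveʳ (∷-injectiveʳ p)) L≡) (∷-injectiveʳ R≡)) T≡
  with refl ← pad-injective θ L≡ | refl ← pad-injective θ (∷-injectiveʳ R≡) = refl

-- Here `w` is the running sum of the removed rows. The recursion treats the sum after one more step
-- as a single centre column; afterwards `pad-⊕⁻¹` splits that column into its contributions.
Encodes-surjective : (w : Vec ℕ (suc m)) (T : Triangle m) → NonzeroRows T →
  Σ[ r ∈ ℕ ] Σ[ S ∈ Sides r ] Σ[ θ ∈ Padding r m ] Σ[ c ∈ Vec ℕ (suc r) ]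
    Encodes S T θ × pad θ c ≡ w × Valid c S
Encodes-surjective w [] _ = 0 , [] , base , w , base , refl , tt
Encodes-surjective (w₀ ∷ w) (u ∷ T) (u≢0 , nz) with head (w ⊕ u) ≟ 0
-- A nonzero deciding entry: `u` is a padded `L` whose partner `R` is zero, and the entry itself
-- witnesses (b).
Encodes-surjective (w₀ ∷ w) (u ∷ T) (u≢0 , nz) | no h≢0
  with r , S , θ , x , e , p , v ← Encodes-surjective (w ⊕ u) T nz
  with c , L , refl , refl , refl ← pad-⊕⁻¹ θ w u p =
  suc r , ⟨ replicate (suc r) 0 , L ⟩∷ S , keep θ , w₀ ∷ c , single L e , refl
  , u≢0 ∘ trans (sum-pad θ L)
  , inj₂ (h≢0 ∘ trans (trans (sym (cong head p))
                           (trans (head-pad e (c ⊕ L)) (sym (cong head (⊕-zeros (c ⊕ L)))))))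
  , subst (λ y → Valid y S) (sym (⊕-zeros (c ⊕ L))) v
-- The bottom row has one cell, nonzero by assumption, so a zero entry cannot occur without another
-- row left to serve as `L`.
Encodes-surjective (w₀ ∷ a ∷ []) ((b ∷ []) ∷ []) (u≢0 , nz) | yes h≡0 =
  ⊥-elim (u≢0 (trans (+-identityʳ b) (m+n≡0⇒n≡0 a h≡0)))
-- A zero deciding entry is the inserted zero: `u` is a padded `R` and `u′` the padded `L` of the
-- same pair.
Encodes-surjective (w₀ ∷ a ∷ w) ((b ∷ u) ∷ (u′ ∷ T)) (u≢0 , u′≢0 , nz) | yes h≡0
  with refl ← m+n≡0⇒m≡0 a h≡0 | refl ← m+n≡0⇒n≡0 a h≡0
  with r , S , θ , x , e , p , v ← Encodes-surjective (w ⊕ u′ ⊕ u) T nz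
  with y , R , q , refl , refl ← pad-⊕⁻¹ θ (w ⊕ u′) u p
  with c , L , refl , refl , refl ← pad-⊕⁻¹ θ w u′ q =
  suc r , ⟨ R , L ⟩∷ S , keep (skip θ) , w₀ ∷ c , double R L R≢0 e , refl
  , u′≢0 ∘ trans (sum-pad θ L) , inj₁ R≢0 , v
  where R≢0 = u≢0 ∘ trans (sum-pad θ R)

-- Size and last-column sum under the encoding.

sumTriangle : Triangle m → ℕ
sumTriangle []      = 0
sumTriangle (v ∷ T) = sum v + sumTriangle T

sumFinals : Triangle m → ℕ
sumFinals []      = 0
sumFinals (v ∷ T) = final v + sumFinals T

sumSides : Sides r → ℕ
sumSides []             = 0
sumSides (⟨ R , L ⟩∷ S) = sum R + (sum L + sumSides S)

sumSideFinals : Sides r → ℕ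
sumSideFinals []             = 0
sumSideFinals (⟨ R , L ⟩∷ S) = final R + (final L + sumSideFinals S)

Encodes-sum : ∀ {S : Sides r} {T : Triangle m} {θ} → Encodes S T θ →
              sumTriangle T ≡ sumSides S
Encodes-sum base = refl
Encodes-sum {r = suc r} {S = ⟨ _ , _ ⟩∷ S} {θ = keep θ} (single L e) =
  trans (cong₂ _+_ (sum-pad θ L) (Encodes-sum e)) (cong (_+ (sum L + sumSides S)) (sym (sum-zeros r)))
Encodes-sum {θ = keep (skip θ)} (double R L _ e) =
  cong₂ _+_ (sum-pad θ R) (cong₂ _+_ (sum-pad θ L) (Encodes-sum e))

-- Padding preserves the last cell, so the first-row entries of the side columns all land in the
-- last column of the image.
Encodes-finals : ∀ {S : Sides r} {T : Triangle m} {θ} → Encodes S T θ →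
                sumFinals T ≡ sumSideFinals S
Encodes-finals base = refl
Encodes-finals {r = suc r} {S = ⟨ _ , _ ⟩∷ S} {θ = keep θ} (single L e) =
  trans (cong₂ _+_ (final-pad θ L) (Encodes-finals e)) (cong (_+ (final L + sumSideFinals S)) (sym (final-zeros r)))
Encodes-finals {θ = keep (skip θ)} (double R L _ e) =
  cong₂ _+_ (trans (final-∷ 0 (pad θ R)) (final-pad θ R)) (cong₂ _+_ (final-pad θ L) (Encodes-finals e))

-- Triangles as upper-triangular matrices and the set B(n).

toRows : Triangle n → Vec (Vec ℕ n) n
toRows []      = []
toRows (v ∷ T) = v ∷ map (0 ∷_) (toRows T)

map-injective : {A B : Set} {f : A → B} → (∀ {x y} → f x ≡ f y → x ≡ y) →
                {X Y : Vec A n} → map f X ≡ map f Y → X ≡ Y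
map-injective h {[]}    {[]}    _ = refl
map-injective h {x ∷ X} {y ∷ Y} e =
  cong₂ _∷_ (h (∷-injectiveˡ e)) (map-injective h (∷-injectiveʳ e))

toRows-injective : {T U : Triangle n} → toRows T ≡ toRows U → T ≡ U
toRows-injective {T = []}    {[]}    _ = refl
toRows-injective {T = v ∷ T} {w ∷ U} e =
  cong₂ _∷_ (∷-injectiveˡ e) (toRows-injective (map-injective ∷-injectiveʳ (∷-injectiveʳ e)))

IsUpper : Vec (Vec ℕ n) n → Set
IsUpper M = ∀ i j → toℕ j < toℕ i → lookup (lookup M i) j ≡ 0

toRows-upper : (T : Triangle n) → IsUpper (toRows T)
toRows-upper (v ∷ T) (Fin.suc i) Fin.zero    _   =
  cong (λ u → lookup u Fin.zero) (lookup-map i (0 ∷_) (toRows T))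
toRows-upper (v ∷ T) (Fin.suc i) (Fin.suc j) j<i =
  trans (cong (λ u → lookup u (Fin.suc j)) (lookup-map i (0 ∷_) (toRows T)))
        (toRows-upper T i j (s<s⁻¹ j<i))

0∷-tails : (X : Vec (Vec ℕ (suc n)) m) → (∀ i → lookup (lookup X i) Fin.zero ≡ 0) →
           map (0 ∷_) (map tail X) ≡ X
0∷-tails []            h = refl
0∷-tails ((x ∷ v) ∷ X) h =
  cong₂ _∷_ (cong (_∷ v) (sym (h Fin.zero))) (0∷-tails X (h ∘ Fin.suc))

lookup-tail : (v : Vec ℕ (suc n)) (j : Fin n) → lookup (tail v) j ≡ lookup v (Fin.suc j)
lookup-tail (x ∷ v) j = refl

toRows-surjective : (M : Vec (Vec ℕ n) n) → IsUpper M → Σ[ T ∈ Triangle n ] toRows T ≡ M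
toRows-surjective []      _ = [] , refl
toRows-surjective (v ∷ X) h
  with T , p ← toRows-surjective (map tail X) (λ i j j<i →
         trans (cong (λ u → lookup u j) (lookup-map i tail X))
               (trans (lookup-tail (lookup X i) j) (h (Fin.suc i) (Fin.suc j) (s<s j<i)))) =
  v ∷ T , cong (v ∷_) (trans (cong (map (0 ∷_)) p) (0∷-tails X λ i → h (Fin.suc i) Fin.zero z<s))

sum-toRows : (T : Triangle n) → sum (map sum (toRows T)) ≡ sumTriangle T
sum-toRows []      = refl
sum-toRows (v ∷ T) =
  cong (sum v +_) (trans (cong sum (sym (map-∘ sum (0 ∷_) (toRows T)))) (sum-toRows T))

lookup-fromℕ : (v : Vec ℕ (suc n)) → lookup v (fromℕ n) ≡ final v
lookup-fromℕ (x ∷ [])    = refl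
lookup-fromℕ (x ∷ y ∷ v) = lookup-fromℕ (y ∷ v)

lastColumn-toRows : (T : Triangle (suc n)) →
                    sum (map (λ row → lookup row (fromℕ n)) (toRows T)) ≡ sumFinals T
lastColumn-toRows {zero}  (v ∷ [])      = cong (_+ 0) (lookup-fromℕ v)
lastColumn-toRows {suc n} (v ∷ T) =
  cong₂ _+_ (lookup-fromℕ v)
    (trans (cong sum (sym (map-∘ _ (0 ∷_) (toRows T)))) (lastColumn-toRows T))

sum≢0⇒∃ : (v : Vec ℕ n) → sum v ≢ 0 → Σ[ j ∈ Fin n ] lookup v j ≢ 0
sum≢0⇒∃ []          h = ⊥-elim (h refl)
sum≢0⇒∃ (zero  ∷ v) h with j , p ← sum≢0⇒∃ v h = Fin.suc j , p
sum≢0⇒∃ (suc x ∷ v) h = Fin.zero , λ ()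

∃⇒sum≢0 : (v : Vec ℕ n) (j : Fin n) → lookup v j ≢ 0 → sum v ≢ 0
∃⇒sum≢0 (x ∷ v) Fin.zero    h e = h (m+n≡0⇒m≡0 x e)
∃⇒sum≢0 (x ∷ v) (Fin.suc j) h e = ∃⇒sum≢0 v j h (m+n≡0⇒n≡0 x e)

sum-lookup-0∷ : (X : Vec (Vec ℕ n) m) (i : Fin m) →
                sum (lookup (map (0 ∷_) X) i) ≡ sum (lookup X i)
sum-lookup-0∷ X i = cong sum (lookup-map i (0 ∷_) X)

nonzeroRows⁺ : (T : Triangle n) → NonzeroRows T → ∀ i → sum (lookup (toRows T) i) ≢ 0
nonzeroRows⁺ (v ∷ T) (v≢0 , _)  Fin.zero    = v≢0
nonzeroRows⁺ (v ∷ T) (_   , nz) (Fin.suc i) =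
  nonzeroRows⁺ T nz i ∘ trans (sym (sum-lookup-0∷ (toRows T) i))

nonzeroRows⁻ : (T : Triangle n) → (∀ i → sum (lookup (toRows T) i) ≢ 0) → NonzeroRows T
nonzeroRows⁻ []      h = tt
nonzeroRows⁻ (v ∷ T) h = h Fin.zero , nonzeroRows⁻ T λ i →
  h (Fin.suc i) ∘ trans (sum-lookup-0∷ (toRows T) i)

triangular : Vec ℕ (suc m) → Triangle m → SqMatrix
triangular {m} v T = m , toRows (v ∷ T)

triangular∈B : (v : Vec ℕ (suc m)) (T : Triangle m) → NonzeroRows T →
               B (sum v + sumTriangle T) (triangular v T)
triangular∈B v T nz =
    (λ i j j<i → toRows-upper (v ∷ T) i j (s<s⁻¹ j<i))
  , sum-toRows (v ∷ T)
  -- The first row `v` is exempt; the row numbered i + 2 is row `i` of `T` counted from 0.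
  , λ { (suc (suc i)) (s≤s (s≤s _)) i<d →
        let k = fromℕ< (s<s⁻¹ i<d) in
        Fin.suc k , cong (suc ∘ suc) (toℕ-fromℕ< _) , sum≢0⇒∃ (lookup (map (0 ∷_) (toRows T)) k)
          (nonzeroRows⁺ T nz k ∘ trans (sym (sum-lookup-0∷ (toRows T) k))) }

B⇒triangular : ∀ A → B n A → Σ[ m ∈ ℕ ] Σ[ v ∈ Vec ℕ (suc m) ] Σ[ T ∈ Triangle m ]
                 triangular v T ≡ A × NonzeroRows T
B⇒triangular (m , M) (up , _ , rows)
  with v ∷ T , refl ← toRows-surjective M (λ i j j<i → up i j (s<s j<i)) =
  m , v , T , refl , nonzeroRows⁻ T λ i →
    row i ∘ trans (sum-lookup-0∷ (toRows T) i)
  where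
  row : ∀ i → sum (lookup (map (0 ∷_) (toRows T)) i) ≢ 0
  row i with rows (suc (suc (toℕ i))) (s≤s (s≤s z≤n)) (s≤s (toℕ<n i))
  ... | Fin.suc k , e , j , h with refl ← toℕ-injective (suc-injective (suc-injective e)) =
    ∃⇒sum≢0 (lookup (map (0 ∷_) (toRows T)) k) j h

-- Finite sums over initial segments of the naturals.

∑ : ℕ → (ℕ → ℕ) → ℕ
∑ zero    f = 0
∑ (suc n) f = f n + ∑ n f

∑-cong : ∀ n {f g : ℕ → ℕ} → (∀ i → i < n → f i ≡ g i) → ∑ n f ≡ ∑ n g
∑-cong zero    h = refl
∑-cong (suc n) h = cong₂ _+_ (h n ≤-refl) (∑-cong n λ i i<n → h i (m<n⇒m<1+n i<n))

∑-suc : ∀ n f → ∑ (suc n) f ≡ f 0 + ∑ n (f ∘ suc)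
∑-suc zero    f = refl
∑-suc (suc n) f = begin
  f (suc n) + ∑ (suc n) f             ≡⟨ cong (f (suc n) +_) (∑-suc n f) ⟩
  f (suc n) + (f 0 + ∑ n (f ∘ suc))   ≡⟨ x∙yz≈y∙xz (f (suc n)) (f 0) _ ⟩
  f 0 + ∑ (suc n) (f ∘ suc)           ∎
  where open ≡-Reasoning

∑-+ : ∀ n f g → ∑ n (λ i → f i + g i) ≡ ∑ n f + ∑ n g
∑-+ zero    f g = refl
∑-+ (suc n) f g = trans (cong (f n + g n +_) (∑-+ n f g)) (interchange (f n) (g n) _ _)

∑-0 : ∀ n → ∑ n (λ _ → 0) ≡ 0
∑-0 zero    = refl
∑-0 (suc n) = ∑-0 n

∑-swap : ∀ n k (f : ℕ → ℕ → ℕ) → ∑ n (λ i → ∑ k (f i)) ≡ ∑ k (λ j → ∑ n (λ i → f i j))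
∑-swap zero    k f = sym (∑-0 k)
∑-swap (suc n) k f = trans (cong (∑ k (f n) +_) (∑-swap n k f)) (sym (∑-+ k (f n) _))

∑-truncate : ∀ {n k f} → n ≤ k → (∀ i → n ≤ i → i < k → f i ≡ 0) → ∑ k f ≡ ∑ n f
∑-truncate {n} {k} {f} n≤k h = go (≤⇒≤′ n≤k) h
  where
  go : ∀ {k} → n ≤′ k → (∀ i → n ≤ i → i < k → f i ≡ 0) → ∑ k f ≡ ∑ n f
  go ≤′-refl h = refl
  go (≤′-step {k} n≤k) h =
    trans (cong (_+ ∑ k f) (h k (≤′⇒≤ n≤k) ≤-refl)) (go n≤k λ i p q → h i p (m<n⇒m<1+n q))

∑≢0 : ∀ {n f i} → i < n → f i ≢ 0 → ∑ n f ≢ 0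
∑≢0 {suc n} {f} {i} i<1+n fi≢0 e with m<1+n⇒m<n∨m≡n i<1+n
... | inj₁ i<n  = ∑≢0 i<n fi≢0 (m+n≡0⇒n≡0 (f n) e)
... | inj₂ refl = fi≢0 (m+n≡0⇒m≡0 (f n) e)

∑≢0⁻¹ : ∀ n {f} → ∑ n f ≢ 0 → Σ[ i ∈ ℕ ] i < n × f i ≢ 0
∑≢0⁻¹ zero        h = ⊥-elim (h refl)
∑≢0⁻¹ (suc n) {f} h with f n ≟ 0
... | no  fn≢0 = n , ≤-refl , fn≢0
... | yes fn≡0 with i , i<n , p ← ∑≢0⁻¹ n (h ∘ trans (cong (_+ ∑ n f) fn≡0)) =
  i , m<n⇒m<1+n i<n , p

-- Peeling off both outermost terms and shifting the rest by one reduces `r`. It serves to pair the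
-- columns symmetric about the centre.
∑-fold : ∀ r g → ∑ (suc (r + r)) g ≡ g r + ∑ r (λ j → g (r + r ∸ j) + g j)
∑-fold zero    g = refl
∑-fold (suc r) g = begin
  g D + ∑ D g
    ≡⟨ cong (g D +_) (∑-suc (r + suc r) g) ⟩
  g D + (g 0 + ∑ (r + suc r) (g ∘ suc))
    ≡⟨ cong (λ k → g D + (g 0 + ∑ k (g ∘ suc))) (+-suc r r) ⟩
  g D + (g 0 + ∑ (suc (r + r)) (g ∘ suc))
    ≡⟨ sym (+-assoc (g D) (g 0) _) ⟩
  g D + g 0 + ∑ (suc (r + r)) (g ∘ suc)
    ≡⟨ cong (g D + g 0 +_) (∑-fold r (g ∘ suc)) ⟩
  g D + g 0 + (g (suc r) + ∑ r (λ j → g (suc (r + r ∸ j)) + g (suc j)))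
    ≡⟨ x∙yz≈y∙xz (g D + g 0) (g (suc r)) _ ⟩
  g (suc r) + (g D + g 0 + ∑ r (λ j → g (suc (r + r ∸ j)) + g (suc j)))
    ≡⟨ cong (λ s → g (suc r) + (g D + g 0 + s)) (∑-cong r λ j j<r →
         cong (λ k → g k + g (suc j)) (sym (shift j<r))) ⟩
  g (suc r) + (g D + g 0 + ∑ r (λ j → g (D ∸ suc j) + g (suc j)))
    ≡⟨ cong (g (suc r) +_) (sym (∑-suc r _)) ⟩
  g (suc r) + ∑ (suc r) (λ j → g (D ∸ j) + g j) ∎
  where
  open ≡-Reasoning
  D = suc r + suc r
  shift : ∀ {j} → j < r → r + suc r ∸ j ≡ suc (r + r ∸ j)
  shift {j} j<r = trans (cong (_∸ j) (+-suc r r)) (+-∸-assoc 1 (≤-trans (<⇒≤ j<r) (m≤m+n r r)))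

-- Columns given by entries, read from the bottom up.

segment : ∀ n → (ℕ → ℕ) → Vec ℕ n
segment zero    f = []
segment (suc n) f = f n ∷ segment n f

segment-cong : ∀ n {f g} → (∀ i → i < n → f i ≡ g i) → segment n f ≡ segment n g
segment-cong zero    h = refl
segment-cong (suc n) h = cong₂ _∷_ (h n ≤-refl) (segment-cong n λ i i<n → h i (m<n⇒m<1+n i<n))

segment-injective : ∀ {n f g} → segment n f ≡ segment n g → ∀ {i} → i < n → f i ≡ g i
segment-injective {suc n} e i<1+n with m<1+n⇒m<n∨m≡n i<1+n
... | inj₁ i<n  = segment-injective (∷-injectiveʳ e) i<n
... | inj₂ refl = ∷-injectiveˡ e

sum-segment : ∀ n f → sum (segment n f) ≡ ∑ n f
sum-segment zero    f = refl
sum-segment (suc n) f = cong (f n +_) (sum-segment n f)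

final-segment : ∀ n f → final (segment (suc n) f) ≡ f 0
final-segment zero    f = refl
final-segment (suc n) f = trans (final-∷ (f (suc n)) (segment (suc n) f)) (final-segment n f)

⊕-segment : ∀ n f g → segment n f ⊕ segment n g ≡ segment n (λ i → f i + g i)
⊕-segment zero    f g = refl
⊕-segment (suc n) f g = cong (f n + g n ∷_) (⊕-segment n f g)

-- This undoes `segment`: `i` is a row index counted from 0 at the top, so the head answers to the
-- largest index. The default 0 fills the cells below the free ones.
entryFromBottom : Vec ℕ n → ℕ → ℕ
entryFromBottom []              i = 0
entryFromBottom {suc n} (x ∷ v) i with i ≟ n
... | yes _ = x
... | no  _ = entryFromBottom v i

entryFromBottom-≥ : (v : Vec ℕ n) {i : ℕ} → n ≤ i → entryFromBottom v i ≡ 0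
entryFromBottom-≥ []                  n≤i = refl
entryFromBottom-≥ {suc n} (x ∷ v) {i} n<i with i ≟ n
... | yes refl = ⊥-elim (<-irrefl refl n<i)
... | no  _    = entryFromBottom-≥ v (<⇒≤ n<i)

segment-entryFromBottom : (v : Vec ℕ n) → segment n (entryFromBottom v) ≡ v
segment-entryFromBottom []              = refl
segment-entryFromBottom {suc n} (x ∷ v) = cong₂ _∷_ top
  (trans (segment-cong n below) (segment-entryFromBottom v))
  where
  top : entryFromBottom (x ∷ v) n ≡ x
  top with n ≟ n
  ... | yes _   = refl
  ... | no  n≢n = ⊥-elim (n≢n refl)
  below : ∀ i → i < n → entryFromBottom (x ∷ v) i ≡ entryFromBottom v i
  below i i<n with i ≟ n
  ... | yes refl = ⊥-elim (<-irrefl refl i<n)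
  ... | no  _    = refl

-- `D` stays fixed while `r` decreases, so the pair at level j always consists of columns j and D ∸
-- j of the whole matrix.
sides : (ℕ → ℕ → ℕ) → ℕ → ∀ r → Sides r
sides F D zero    = []
sides F D (suc r) =
  ⟨ segment (suc r) (λ i → F i (D ∸ r)) , segment (suc r) (λ i → F i r) ⟩∷ sides F D r

sumSides-sides : ∀ F D r → sumSides (sides F D r) ≡
  ∑ r (λ j → ∑ (suc j) (λ i → F i (D ∸ j)) + ∑ (suc j) (λ i → F i j))
sumSides-sides F D zero    = refl
sumSides-sides F D (suc r) =
  trans (cong₂ _+_ (sum-segment (suc r) (λ i → F i (D ∸ r)))
          (cong₂ _+_ (sum-segment (suc r) (λ i → F i r)) (sumSides-sides F D r)))
        (sym (+-assoc (∑ (suc r) (λ i → F i (D ∸ r))) _ _))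

sumSideFinals-sides : ∀ F D r → sumSideFinals (sides F D r) ≡ ∑ r (λ j → F 0 (D ∸ j) + F 0 j)
sumSideFinals-sides F D zero    = refl
sumSideFinals-sides F D (suc r) =
  trans (cong₂ _+_ (final-segment r (λ i → F i (D ∸ r)))
          (cong₂ _+_ (final-segment r (λ i → F i r)) (sumSideFinals-sides F D r)))
        (sym (+-assoc (F 0 (D ∸ r)) _ _))

Sides-∷-injective : {R R′ L L′ : Vec ℕ (suc r)} {S S′ : Sides r} →
                    _≡_ {A = Sides (suc r)} (⟨ R , L ⟩∷ S) (⟨ R′ , L′ ⟩∷ S′) →
                    R ≡ R′ × L ≡ L′ × S ≡ S′
Sides-∷-injective refl = refl , refl , refl

Sides-∷-cong : {R R′ L L′ : Vec ℕ (suc r)} {S S′ : Sides r} → R ≡ R′ → L ≡ L′ → S ≡ S′ →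
               _≡_ {A = Sides (suc r)} (⟨ R , L ⟩∷ S) (⟨ R′ , L′ ⟩∷ S′)
Sides-∷-cong refl refl refl = refl

sides-injective : ∀ {F G D r} → sides F D r ≡ sides G D r → ∀ {i j} → i ≤ j → j < r →
                  F i (D ∸ j) ≡ G i (D ∸ j) × F i j ≡ G i j
sides-injective {r = suc r} e i≤j j<1+r
  with R≡ , L≡ , S≡ ← Sides-∷-injective e | m<1+n⇒m<n∨m≡n j<1+r
... | inj₁ j<r  = sides-injective S≡ i≤j j<r
... | inj₂ refl = segment-injective R≡ (s≤s i≤j) , segment-injective L≡ (s≤s i≤j)

sideEntries : Sides r → ℕ → ℕ → ℕ × ℕ
sideEntries []                       j i = 0 , 0
sideEntries {suc r} (⟨ R , L ⟩∷ S) j i with j ≟ r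
... | yes _ = entryFromBottom R i , entryFromBottom L i
... | no  _ = sideEntries S j i

sideEntries-> : (S : Sides r) {i j : ℕ} → j < i → sideEntries S j i ≡ (0 , 0)
sideEntries-> []                           j<i = refl
sideEntries-> {suc r} (⟨ R , L ⟩∷ S) {i} {j} j<i with j ≟ r
... | yes refl = cong₂ _,_ (entryFromBottom-≥ R j<i) (entryFromBottom-≥ L j<i)
... | no  _    = sideEntries-> S j<i

sides-sideEntries : ∀ F D (S : Sides r) →
  (∀ i j → i ≤ j → j < r → (F i (D ∸ j) , F i j) ≡ sideEntries S j i) → sides F D r ≡ S
sides-sideEntries {zero}  F D []               h = refl
sides-sideEntries {suc r} F D (⟨ R , L ⟩∷ S) h
  = Sides-∷-cong
      (trans (segment-cong (suc r) λ i i<1+r → cong proj₁ (outer i i<1+r)) (segment-entryFromBottom R))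
      (trans (segment-cong (suc r) λ i i<1+r → cong proj₂ (outer i i<1+r)) (segment-entryFromBottom L))
      (sides-sideEntries F D S inner)
  where
  outer : ∀ i → i < suc r → (F i (D ∸ r) , F i r) ≡ (entryFromBottom R i , entryFromBottom L i)
  outer i i<1+r with r ≟ r | h i r (s≤s⁻¹ i<1+r) ≤-refl
  ... | yes _   | p = p
  ... | no  r≢r | _ = ⊥-elim (r≢r refl)
  inner : ∀ i j → i ≤ j → j < r → (F i (D ∸ j) , F i j) ≡ sideEntries S j i
  inner i j i≤j j<r with j ≟ r | h i j i≤j (m<n⇒m<1+n j<r)
  ... | yes refl | _ = ⊥-elim (<-irrefl refl j<r)
  ... | no  _    | p = p

-- `Valid` compared with conditions (a) and (b) on entries.

merge : (ℕ → ℕ → ℕ) → ℕ → ℕ → (ℕ → ℕ) → ℕ → ℕ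
merge F D r w i = w i + F i r + F i (D ∸ r)

⊕-merge : ∀ F D r w →
          segment (suc r) w ⊕ segment (suc r) (λ i → F i r) ⊕ segment (suc r) (λ i → F i (D ∸ r))
          ≡ segment (suc r) (merge F D r w)
⊕-merge F D r w =
  trans (cong (_⊕ segment (suc r) (λ i → F i (D ∸ r))) (⊕-segment (suc r) w (λ i → F i r)))
        (⊕-segment (suc r) (λ i → w i + F i r) (λ i → F i (D ∸ r)))

-- Conditions (a) and (b) counted from 0. The witness in row j is confined to columns j to D ∸ j
-- because these are exactly the columns merged when `Valid` inspects that row.
HookConditions : (ℕ → ℕ → ℕ) → ℕ → ℕ → Set
HookConditions F D r = ∀ j → j < r →
    ∑ (suc j) (λ i → F i j) ≢ 0
  × (∑ (suc j) (λ i → F i (D ∸ j)) ≢ 0 ⊎ (Σ[ k ∈ ℕ ] j ≤ k × k + j ≤ D × F j k ≢ 0))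

-- In the recursion w i sums the entries of row i in columns r, …, D ∸ r.
Valid⁺ : ∀ F D r w → (∀ i k → r ≤ k → k + r ≤ D → F i k ≢ 0 → w i ≢ 0) →
         HookConditions F D r → Valid (segment (suc r) w) (sides F D r)
Valid⁺ F D zero    w h hooks = tt
Valid⁺ F D (suc r) w h hooks with L≢0 , row ← hooks r ≤-refl =
    L≢0 ∘ trans (sym (sum-segment (suc r) _))
  , hook row
  , subst (λ c → Valid c (sides F D r)) (sym (⊕-merge F D r w))
      (Valid⁺ F D r (merge F D r w) h′ λ j j<r → hooks j (m<n⇒m<1+n j<r))
  where
  h′ : ∀ i k → r ≤ k → k + r ≤ D → F i k ≢ 0 → merge F D r w i ≢ 0
  h′ i k r≤k k+r≤D Fik≢0 e with k ≟ r | k ≟ D ∸ r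
  ... | yes refl | _        = Fik≢0 (m+n≡0⇒n≡0 (w i) (m+n≡0⇒m≡0 (w i + F i k) e))
  ... | no  _    | yes refl = Fik≢0 (m+n≡0⇒n≡0 (w i + F i r) e)
  -- The entry lies in neither merged column, hence strictly between them, where the hypothesis on
  -- `w` applies.
  ... | no  k≢r  | no k≢D∸r =
    h i k (≤∧≢⇒< r≤k (k≢r ∘ sym))
      (subst (_≤ D) (sym (+-suc k r))
        (≤∧≢⇒< k+r≤D λ k+r≡D → k≢D∸r (trans (sym (m+n∸n≡m k r)) (cong (_∸ r) k+r≡D))))
      Fik≢0 (m+n≡0⇒m≡0 (w i) (m+n≡0⇒m≡0 (w i + F i r) e))
  hook : ∑ (suc r) (λ i → F i (D ∸ r)) ≢ 0 ⊎ (Σ[ k ∈ ℕ ] r ≤ k × k + r ≤ D × F r k ≢ 0) →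
         sum (segment (suc r) (λ i → F i (D ∸ r))) ≢ 0 ⊎ merge F D r w r ≢ 0
  hook (inj₁ R≢0) = inj₁ (R≢0 ∘ trans (sym (sum-segment (suc r) (λ i → F i (D ∸ r)))))
  hook (inj₂ (k , r≤k , k+r≤D , Frk≢0)) = inj₂ (h′ r k r≤k k+r≤D Frk≢0)

merge≢0 : ∀ F D r w → r ≤ D → (∀ i → w i ≢ 0 → Σ[ k ∈ ℕ ] k ≤ D × F i k ≢ 0) →
          ∀ i → merge F D r w i ≢ 0 → Σ[ k ∈ ℕ ] k ≤ D × F i k ≢ 0
merge≢0 F D r w r≤D h i m≢0 with w i ≟ 0 | F i r ≟ 0
... | no  w≢0 | _       = h i w≢0
... | yes _   | no  F≢0 = r , r≤D , F≢0
... | yes w≡0 | yes F≡0 = D ∸ r , m∸n≤m D r , m≢0 ∘ cong₂ _+_ (cong₂ _+_ w≡0 F≡0)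

-- Every nonzero value of the running sum stems from a nonzero entry in the same row, and `merge`
-- preserves this; so the test in `Valid` yields a nonzero row.
Valid⁻ : ∀ F D r w → r ≤ D → (∀ i → w i ≢ 0 → Σ[ k ∈ ℕ ] k ≤ D × F i k ≢ 0) →
         Valid (segment (suc r) w) (sides F D r) → ∀ j → j < r →
           ∑ (suc j) (λ i → F i j) ≢ 0
         × (∑ (suc j) (λ i → F i (D ∸ j)) ≢ 0 ⊎ (Σ[ k ∈ ℕ ] k ≤ D × F j k ≢ 0))
Valid⁻ F D (suc r) w r<D h (L≢0 , hook , v) j j<1+r with m<1+n⇒m<n∨m≡n j<1+r
... | inj₁ j<r =
  Valid⁻ F D r (merge F D r w) (<⇒≤ r<D) (merge≢0 F D r w (<⇒≤ r<D) h)
    (subst (λ c → Valid c (sides F D r)) (⊕-merge F D r w) v) j j<r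
... | inj₂ refl =
  L≢0 ∘ trans (sum-segment (suc j) _) ,
  Sum.map (_∘ trans (sum-segment (suc j) (λ i → F i (D ∸ j))))
          (merge≢0 F D j w (<⇒≤ r<D) h j) hook

-- Matrices as functions of natural indices.

at : {A : Set} → A → Vec A n → ℕ → A
at x []      i       = x
at x (y ∷ v) zero    = y
at x (y ∷ v) (suc i) = at x v i

at-lookup : {A : Set} (x : A) (v : Vec A n) (i : Fin n) → at x v (toℕ i) ≡ lookup v i
at-lookup x (y ∷ v) Fin.zero    = refl
at-lookup x (y ∷ v) (Fin.suc i) = at-lookup x v i

at-tabulate : {A : Set} (x : A) (g : ℕ → A) {i : ℕ} → i < n → at x (tabulate {n = n} (g ∘ toℕ)) i ≡ g i
at-tabulate {suc n} x g {zero}  _   = refl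
at-tabulate {suc n} x g {suc i} i<n = at-tabulate x (g ∘ suc) (s<s⁻¹ i<n)

at-ext : {A : Set} (x : A) {v w : Vec A n} → (∀ {i} → i < n → at x v i ≡ at x w i) → v ≡ w
at-ext x {[]}    {[]}    h = refl
at-ext x {y ∷ v} {z ∷ w} h = cong₂ _∷_ (h z<s) (at-ext x (h ∘ s<s))

sum-map : {A : Set} (x : A) (g : A → ℕ) (v : Vec A n) → sum (map g v) ≡ ∑ n (λ i → g (at x v i))
sum-map         x g []      = refl
sum-map {suc n} x g (y ∷ v) =
  trans (cong (g y +_) (sum-map x g v)) (sym (∑-suc n (λ i → g (at x (y ∷ v) i))))

sum-at : (v : Vec ℕ n) → sum v ≡ ∑ n (at 0 v)
sum-at v = trans (cong sum (sym (map-id v))) (sum-map 0 (λ x → x) v)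

-- Natural indices with value 0 outside the matrix allow column arithmetic such as D ∸ j without
-- bounds in the types.
entries : SqMatrix → ℕ → ℕ → ℕ
entries (d , M) i j = at 0 (at (replicate (suc d) 0) M i) j

entries-entry : ∀ A i j → entries A (toℕ i) (toℕ j) ≡ entry A i j
entries-entry (d , M) i j =
  trans (at-lookup 0 (at (replicate (suc d) 0) M (toℕ i)) j)
        (cong (λ u → lookup u j) (at-lookup (replicate (suc d) 0) M i))

entries-ext : ∀ d {M N} → (∀ {i j} → i < suc d → j < suc d → entries (d , M) i j ≡ entries (d , N) i j) →
              _≡_ {A = SqMatrix} (d , M) (d , N)
entries-ext d h = cong (d ,_) (at-ext (replicate (suc d) 0) λ i<d → at-ext 0 (h i<d))

fromEntries : ℕ → (ℕ → ℕ → ℕ) → SqMatrix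
fromEntries d F = d , tabulate (λ i → tabulate (λ j → F (toℕ i) (toℕ j)))

entries-fromEntries : ∀ {d} F {i j} → i < suc d → j < suc d → entries (fromEntries d F) i j ≡ F i j
entries-fromEntries {d} F {i} {j} i<d j<d =
  trans (cong (λ u → at 0 u j) (at-tabulate (replicate (suc d) 0) (λ i → tabulate (λ j → F i (toℕ j))) i<d))
        (at-tabulate 0 (F i) j<d)

size-∑ : ∀ A → size A ≡ ∑ (dim A) (λ i → ∑ (dim A) (entries A i))
size-∑ (d , M) =
  trans (sum-map (replicate (suc d) 0) sum M) (∑-cong (suc d) λ i _ → sum-at (at _ M i))

colSum-∑ : ∀ A j → colSum A j ≡ ∑ (dim A) (λ i → entries A i (toℕ j))
colSum-∑ (d , M) j =
  trans (sum-map (replicate (suc d) 0) (λ row → lookup row j) M)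
        (∑-cong (suc d) λ i _ → sym (at-lookup 0 (at _ M i) j))

rowSum-∑ : ∀ A → rowSum A (first A) ≡ ∑ (dim A) (entries A 0)
rowSum-∑ (d , v ∷ M) = sum-at v

-- Zero and nonzero cells: numbering from 1 and from 0.

fin : ∀ {i k} → i < k → Σ[ f ∈ Fin k ] toℕ f ≡ i
fin i<k = fromℕ< i<k , toℕ-fromℕ< i<k

NonzeroColumn⁺ : ∀ A {i j} → i < dim A → j < dim A → entries A i j ≢ 0 → NonzeroColumn A (suc j)
NonzeroColumn⁺ A i<d j<d h with i , refl ← fin i<d | j , refl ← fin j<d =
  j , refl , i , h ∘ trans (entries-entry A i j)

NonzeroColumn⁻ : ∀ A {j} → NonzeroColumn A (suc j) → Σ[ i ∈ ℕ ] i < dim A × entries A i j ≢ 0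
NonzeroColumn⁻ A (j , refl , i , h) = toℕ i , toℕ<n i , h ∘ trans (sym (entries-entry A i j))

NonzeroRow⁺ : ∀ A {i j} → i < dim A → j < dim A → entries A i j ≢ 0 → NonzeroRow A (suc i)
NonzeroRow⁺ A i<d j<d h with i , refl ← fin i<d | j , refl ← fin j<d =
  i , refl , j , h ∘ trans (entries-entry A i j)

NonzeroRow⁻ : ∀ A {i} → NonzeroRow A (suc i) → Σ[ j ∈ ℕ ] j < dim A × entries A i j ≢ 0
NonzeroRow⁻ A (i , refl , j , h) = toℕ j , toℕ<n j , h ∘ trans (sym (entries-entry A i j))

-- In dimension 2r + 1, lowering both indices by one turns the SE-condition i + j > 2r + 2 into i +
-- j > 2r.
record IsSuper (r : ℕ) (F : ℕ → ℕ → ℕ) : Set where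
  field
    below : ∀ {i j} → i ≤ r + r → j ≤ r + r → j < i → F i j ≡ 0
    se    : ∀ {i j} → i ≤ r + r → j ≤ r + r → r + r < i + j → F i j ≡ 0

SuperTriangular⇒IsSuper : ∀ M → SuperTriangular (r + r , M) → IsSuper r (entries (r + r , M))
SuperTriangular⇒IsSuper {r} M (up , se) = record { below = below ; se = se′ }
  where
  A : SqMatrix
  A = r + r , M
  below : ∀ {i j} → i ≤ r + r → j ≤ r + r → j < i → entries A i j ≡ 0
  below i≤ j≤ j<i with i , refl ← fin (s≤s i≤) | j , refl ← fin (s≤s j≤) =
    trans (entries-entry A i j) (up i j (s<s j<i))
  se′ : ∀ {i j} → i ≤ r + r → j ≤ r + r → r + r < i + j → entries A i j ≡ 0
  se′ i≤ j≤ D<i+j with i , refl ← fin (s≤s i≤) | j , refl ← fin (s≤s j≤) =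
    trans (entries-entry A i j) (se i j
      (subst₂ _<_ (sym (+-comm (suc (r + r)) 1)) (sym (cong suc (+-suc (toℕ i) (toℕ j)))) (s<s (s<s D<i+j))))

IsSuper⇒SuperTriangular : ∀ M → IsSuper r (entries (r + r , M)) → SuperTriangular (r + r , M)
IsSuper⇒SuperTriangular {r} M s =
    (λ i j j<i → trans (sym (entries-entry (r + r , M) i j))
      (IsSuper.below s (s≤s⁻¹ (toℕ<n i)) (s≤s⁻¹ (toℕ<n j)) (s<s⁻¹ j<i)))
  , (λ i j D<i+j → trans (sym (entries-entry (r + r , M) i j))
      (IsSuper.se s (s≤s⁻¹ (toℕ<n i)) (s≤s⁻¹ (toℕ<n j))
        (s<s⁻¹ (s<s⁻¹ (subst₂ _<_ (+-comm (suc (r + r)) 1) (cong suc (+-suc (toℕ i) (toℕ j))) D<i+j)))))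

-- Sums over the free cells of a super triangular matrix.

centre : (ℕ → ℕ → ℕ) → ∀ r → Vec ℕ (suc r)
centre F r = segment (suc r) (λ i → F i r)

module _ {F} (super : IsSuper r F) where
  open IsSuper super

  private
    D : ℕ
    D = r + r

  left-∑ : ∀ {j} → j ≤ r → ∑ (suc D) (λ i → F i j) ≡ ∑ (suc j) (λ i → F i j)
  left-∑ j≤r = ∑-truncate (s≤s j≤D) λ i j<i i<D → below (s≤s⁻¹ i<D) j≤D j<i
    where j≤D = ≤-trans j≤r (m≤m+n r r)

  -- In column D ∸ j, a row below row j gives an SE-cell, so the right column is cut off at the same
  -- height as its mirror image on the left.
  right-∑ : ∀ {j} → j ≤ r → ∑ (suc D) (λ i → F i (D ∸ j)) ≡ ∑ (suc j) (λ i → F i (D ∸ j))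
  right-∑ {j} j≤r = ∑-truncate (s≤s j≤D) λ i j<i i<D → se (s≤s⁻¹ i<D) (m∸n≤m D j)
    (subst (_< i + (D ∸ j)) (m+[n∸m]≡n j≤D) (+-monoˡ-< (D ∸ j) j<i))
    where j≤D = ≤-trans j≤r (m≤m+n r r)

  total-∑ : ∑ (suc D) (λ i → ∑ (suc D) (F i)) ≡ sum (centre F r) + sumSides (sides F D r)
  total-∑ = begin
    ∑ (suc D) (λ i → ∑ (suc D) (F i))                       ≡⟨ ∑-swap (suc D) (suc D) F ⟩
    ∑ (suc D) column                                        ≡⟨ ∑-fold r column ⟩
    column r + ∑ r (λ j → column (D ∸ j) + column j)        ≡⟨ cong₂ _+_ (left-∑ ≤-refl)
      (∑-cong r λ j j<r → cong₂ _+_ (right-∑ (<⇒≤ j<r)) (left-∑ (<⇒≤ j<r))) ⟩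
    ∑ (suc r) (λ i → F i r) +
      ∑ r (λ j → ∑ (suc j) (λ i → F i (D ∸ j)) + ∑ (suc j) (λ i → F i j))
                                                            ≡⟨ cong₂ _+_
      (sym (sum-segment (suc r) (λ i → F i r))) (sym (sumSides-sides F D r)) ⟩
    sum (centre F r) + sumSides (sides F D r)               ∎
    where
    open ≡-Reasoning
    column : ℕ → ℕ
    column j = ∑ (suc D) (λ i → F i j)

  topRow-∑ : ∑ (suc D) (F 0) ≡ final (centre F r) + sumSideFinals (sides F D r)
  topRow-∑ = trans (∑-fold r (F 0))
    (cong₂ _+_ (sym (final-segment r (λ i → F i r))) (sym (sumSideFinals-sides F D r)))

  support : ∀ {i j} → i ≤ D → j ≤ D → F i j ≢ 0 → i ≤ j × j + i ≤ D
  support {i} {j} i≤D j≤D h =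
      ≮⇒≥ (h ∘ below i≤D j≤D)
    , subst (_≤ D) (+-comm i j) (≮⇒≥ (h ∘ se i≤D j≤D))

-- Membership in SM(n) in terms of centre and sides.

halves : ∀ {d} → suc d ≡ 2 * r + 1 → d ≡ r + r
halves {r} e = suc-injective
  (trans e (trans (+-comm (2 * r) 1) (cong (λ k → suc (r + k)) (+-identityʳ r))))

-- Taking i = r ∸ j in (b) makes it speak of row j and, by `column-index`, of column 2r ∸ j, both
-- counted from 0.
row-index : ∀ {j} → j ≤ r → r + 1 ∸ (r ∸ j) ≡ suc j
row-index {r} {j} j≤r =
  trans (cong (_∸ (r ∸ j)) (+-comm r 1))
        (trans (+-∸-assoc 1 (m∸n≤m r j)) (cong suc (m∸[m∸n]≡n j≤r)))

column-index : ∀ {j} → j ≤ r → r + 1 + (r ∸ j) ≡ suc (r + r ∸ j)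
column-index {r} {j} j≤r = trans (cong (_+ (r ∸ j)) (+-comm r 1)) (cong suc (sym (+-∸-assoc r j≤r)))

record InSM (n r : ℕ) (F : ℕ → ℕ → ℕ) : Set where
  field
    super   : IsSuper r F
    valid   : Valid (centre F r) (sides F (r + r) r)
    size≡n  : sum (centre F r) + sumSides (sides F (r + r) r) ≡ n

SM⇒InSM : ∀ A → SM n A → Σ[ r ∈ ℕ ] Σ[ M ∈ _ ] A ≡ (r + r , M) × InSM n r (entries A)
SM⇒InSM (d , M) (r , tri , size≡n , dim≡ , columns , hooks) with refl ← halves {r} dim≡ =
  r , M , refl , record
    { super  = super
    ; valid  = Valid⁺ F D r (λ i → F i r) centre≢0 λ j j<r → column j<r , hook j<r
    ; size≡n = trans (sym (total-∑ super)) (trans (sym (size-∑ (D , M))) size≡n)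
    }
  where
  D = r + r
  F = entries (D , M)
  super : IsSuper r F
  super = SuperTriangular⇒IsSuper {r} M tri

  -- Before any merging, the range from r to D ∸ r is the centre column alone.
  centre≢0 : ∀ i k → r ≤ k → k + r ≤ D → F i k ≢ 0 → F i r ≢ 0
  centre≢0 i k r≤k k+r≤D h with refl ← ≤-antisym r≤k (+-cancelʳ-≤ r k r k+r≤D) = h

  column : ∀ {j} → j < r → ∑ (suc j) (λ i → F i j) ≢ 0
  column {j} j<r e with i , i<D , h ← NonzeroColumn⁻ (D , M) (columns (suc j) (s≤s z≤n) j<r) =
    ∑≢0 i<D h (trans (left-∑ super (<⇒≤ j<r)) e)

  hook : ∀ {j} → j < r → ∑ (suc j) (λ i → F i (D ∸ j)) ≢ 0 ⊎ (Σ[ k ∈ ℕ ] j ≤ k × k + j ≤ D × F j k ≢ 0)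
  hook {j} j<r with hooks (r ∸ j) (m<n⇒0<n∸m j<r) (m∸n≤m r j)
  ... | inj₁ row with k , k<D , h ← NonzeroRow⁻ (D , M) (subst (NonzeroRow (D , M)) (row-index (<⇒≤ j<r)) row) =
    let j≤k , k+j≤D = support super (≤-trans (<⇒≤ j<r) (m≤m+n r r)) (s≤s⁻¹ k<D) h in
    inj₂ (k , j≤k , k+j≤D , h)
  ... | inj₂ col with i , i<D , h ← NonzeroColumn⁻ (D , M) (subst (NonzeroColumn (D , M)) (column-index (<⇒≤ j<r)) col) =
    inj₁ (∑≢0 i<D h ∘ trans (right-∑ super (<⇒≤ j<r)))

InSM⇒SM : ∀ {M} → InSM n r (entries (r + r , M)) → SM n (r + r , M)
InSM⇒SM {n} {r} {M} inSM =
    r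
  , IsSuper⇒SuperTriangular {r} M super
  , trans (size-∑ A) (trans (total-∑ super) size≡n)
  , trans (cong (λ k → suc (r + k)) (sym (+-identityʳ r))) (+-comm 1 (2 * r))
  , columns , hooks
  where
  open InSM inSM
  A : SqMatrix
  A = r + r , M
  F = entries A
  D = r + r
  conditions : ∀ j → j < r →
      ∑ (suc j) (λ i → F i j) ≢ 0
    × (∑ (suc j) (λ i → F i (D ∸ j)) ≢ 0 ⊎ (Σ[ k ∈ ℕ ] k ≤ D × F j k ≢ 0))
  conditions = Valid⁻ F D r (λ i → F i r) (m≤m+n r r) (λ i h → r , m≤m+n r r , h) valid

  columns : ∀ i → 1 ≤ i → i ≤ r → NonzeroColumn A i
  columns (suc j) _ j<r with i , i≤j , h ← ∑≢0⁻¹ (suc j) (proj₁ (conditions j j<r)) =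
    NonzeroColumn⁺ A (≤-trans i≤j (s≤s j≤D)) (s≤s j≤D) h
    where j≤D = ≤-trans (<⇒≤ j<r) (m≤m+n r r)

  hook : ∀ {j} → j < r → NonzeroRow A (r + 1 ∸ (r ∸ j)) ⊎ NonzeroColumn A (r + 1 + (r ∸ j))
  hook {j} j<r with proj₂ (conditions j j<r)
  ... | inj₂ (k , k≤D , h) =
    inj₁ (subst (NonzeroRow A) (sym (row-index (<⇒≤ j<r)))
      (NonzeroRow⁺ A (s≤s (≤-trans (<⇒≤ j<r) (m≤m+n r r))) (s≤s k≤D) h))
  ... | inj₁ col with i , i≤j , h ← ∑≢0⁻¹ (suc j) col =
    inj₂ (subst (NonzeroColumn A) (sym (column-index (<⇒≤ j<r)))
      (NonzeroColumn⁺ A (≤-trans i≤j (s≤s (≤-trans (<⇒≤ j<r) (m≤m+n r r)))) (s≤s (m∸n≤m D j)) h))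

  hooks : ∀ i → 1 ≤ i → i ≤ r → NonzeroRow A (r + 1 ∸ i) ⊎ NonzeroColumn A (r + 1 + i)
  hooks i 1≤i i≤r =
    subst (λ k → NonzeroRow A (r + 1 ∸ k) ⊎ NonzeroColumn A (r + 1 + k)) (m∸[m∸n]≡n i≤r)
      (hook (∸-monoʳ-< 1≤i i≤r))

-- Assembling a matrix from its centre and sides.

assemble : Vec ℕ (suc r) → Sides r → ℕ → ℕ → ℕ
assemble {r} c S i j with <-cmp j r
... | tri< _ _ _ = proj₂ (sideEntries S j i)
... | tri≈ _ _ _ = entryFromBottom c i
... | tri> _ _ _ = proj₁ (sideEntries S (r + r ∸ j) i)

module _ (c : Vec ℕ (suc r)) (S : Sides r) where

  assemble-left : ∀ i {j} → j < r → assemble c S i j ≡ proj₂ (sideEntries S j i)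
  assemble-left i {j} j<r with <-cmp j r
  ... | tri< _ _ _   = refl
  ... | tri≈ j≮r _ _ = ⊥-elim (j≮r j<r)
  ... | tri> j≮r _ _ = ⊥-elim (j≮r j<r)

  assemble-centre : ∀ i → assemble c S i r ≡ entryFromBottom c i
  assemble-centre i with <-cmp r r
  ... | tri< r<r _ _ = ⊥-elim (<-irrefl refl r<r)
  ... | tri≈ _ _ _   = refl
  ... | tri> _ _ r<r = ⊥-elim (<-irrefl refl r<r)

  assemble-right : ∀ i {j} → j < r → assemble c S i (r + r ∸ j) ≡ proj₁ (sideEntries S j i)
  assemble-right i {j} j<r with <-cmp (r + r ∸ j) r
  ... | tri< _ _ r≮ = ⊥-elim (r≮ (subst (r <_) (sym (+-∸-assoc r (<⇒≤ j<r))) (m<m+n r (m<n⇒0<n∸m j<r))))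
  ... | tri≈ _ _ r≮ = ⊥-elim (r≮ (subst (r <_) (sym (+-∸-assoc r (<⇒≤ j<r))) (m<m+n r (m<n⇒0<n∸m j<r))))
  ... | tri> _ _ _  = cong (λ k → proj₁ (sideEntries S k i)) (m∸[m∸n]≡n (≤-trans (<⇒≤ j<r) (m≤m+n r r)))

  assemble-below : ∀ {i j} → j < i → j ≤ r + r → assemble c S i j ≡ 0
  assemble-below {i} {j} j<i j≤D with <-cmp j r
  ... | tri< _ _ _    = cong proj₂ (sideEntries-> S j<i)
  ... | tri≈ _ refl _ = entryFromBottom-≥ c j<i
  -- The free cells of a right column reach down only to row D ∸ j, and D ∸ j ≤ r < j < i.
  ... | tri> _ _ r<j  = cong proj₁ (sideEntries-> S
    (<-trans (≤-<-trans (≤-trans (∸-monoʳ-≤ (r + r) (<⇒≤ r<j)) (≤-reflexive (m+n∸n≡m r r))) r<j) j<i))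

  assemble-se : ∀ {i j} → r + r < i + j → j ≤ r + r → assemble c S i j ≡ 0
  assemble-se {i} {j} D<i+j j≤D with <-cmp j r
  -- From 2r < i + j and j < r follows j < r < i, so the cell is below the free cells of column j.
  ... | tri< j<r _ _  = cong proj₂ (sideEntries-> S (<-trans j<r
    (+-cancelʳ-< r r i (<-trans D<i+j (+-monoʳ-< i j<r)))))
  ... | tri≈ _ refl _ = entryFromBottom-≥ c (+-cancelʳ-< r r i D<i+j)
  ... | tri> _ _ _    = cong proj₁ (sideEntries-> S
    (+-cancelʳ-< j (r + r ∸ j) i (subst (_< i + j) (sym (m∸n+n≡m j≤D)) D<i+j)))

assembled : Vec ℕ (suc r) → Sides r → SqMatrix
assembled {r} c S = fromEntries (r + r) (assemble c S)

module _ (c : Vec ℕ (suc r)) (S : Sides r) where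

  private
    F : ℕ → ℕ → ℕ
    F = entries (assembled c S)

    F≡ : ∀ {i j} → i ≤ r + r → j ≤ r + r → F i j ≡ assemble c S i j
    F≡ i≤D j≤D = entries-fromEntries (assemble c S) (s≤s i≤D) (s≤s j≤D)

    ≤D : ∀ {i} → i ≤ r → i ≤ r + r
    ≤D i≤r = ≤-trans i≤r (m≤m+n r r)

  centre-assembled : centre F r ≡ c
  centre-assembled = trans
    (segment-cong (suc r) λ i i≤r →
      trans (F≡ (≤D (s≤s⁻¹ i≤r)) (m≤m+n r r)) (assemble-centre c S i))
    (segment-entryFromBottom c)

  sides-assembled : sides F (r + r) r ≡ S
  sides-assembled = sides-sideEntries F (r + r) S λ i j i≤j j<r →
    let i≤D = ≤D (≤-trans i≤j (<⇒≤ j<r)) in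
    cong₂ _,_ (trans (F≡ i≤D (m∸n≤m (r + r) j)) (assemble-right c S i j<r))
              (trans (F≡ i≤D (≤D (<⇒≤ j<r))) (assemble-left c S i j<r))

  InSM-assembled : Valid c S → InSM (sum c + sumSides S) r F
  InSM-assembled v = record
    { super  = record
      { below = λ i≤D j≤D j<i → trans (F≡ i≤D j≤D) (assemble-below c S j<i j≤D)
      ; se    = λ i≤D j≤D D<i+j → trans (F≡ i≤D j≤D) (assemble-se c S D<i+j j≤D) }
    ; valid  = subst₂ Valid (sym centre-assembled) (sym sides-assembled) v
    ; size≡n = cong₂ (λ c S → sum c + sumSides S) centre-assembled sides-assembled }

-- Each cell is either forced to be zero or is a free cell of the centre or of a side column.
entries-injective : ∀ {M N} → let F = entries (r + r , M); G = entries (r + r , N) in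
  IsSuper r F → IsSuper r G →
  centre F r ≡ centre G r → sides F (r + r) r ≡ sides G (r + r) r →
  _≡_ {A = SqMatrix} (r + r , M) (r + r , N)
entries-injective {r} {M} {N} sF sG c≡ S≡ = entries-ext (r + r) λ i<D j<D → eq (s≤s⁻¹ i<D) (s≤s⁻¹ j<D)
  where
  F = entries (r + r , M)
  G = entries (r + r , N)
  eq : ∀ {i j} → i ≤ r + r → j ≤ r + r → F i j ≡ G i j
  eq {i} {j} i≤D j≤D with j <? i | r + r <? i + j | <-cmp j r
  ... | yes j<i | _         | _ = trans (IsSuper.below sF i≤D j≤D j<i) (sym (IsSuper.below sG i≤D j≤D j<i))
  ... | no  _   | yes D<i+j | _ = trans (IsSuper.se sF i≤D j≤D D<i+j) (sym (IsSuper.se sG i≤D j≤D D<i+j))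
  ... | no  j≮i | no _      | tri< j<r _ _  = proj₂ (sides-injective S≡ (≮⇒≥ j≮i) j<r)
  ... | no  j≮i | no _      | tri≈ _ refl _ = segment-injective c≡ (s≤s (≮⇒≥ j≮i))
  ... | no  _   | no D≮i+j  | tri> _ _ r<j  =
    subst (λ k → F i k ≡ G i k) (m∸[m∸n]≡n j≤D) (proj₁ (sides-injective S≡ i≤D∸j D∸j<r))
    where
    i≤D∸j : i ≤ r + r ∸ j
    i≤D∸j = subst (_≤ r + r ∸ j) (m+n∸n≡m i j) (∸-monoˡ-≤ j (≮⇒≥ D≮i+j))
    D∸j<r : r + r ∸ j < r
    D∸j<r = subst (r + r ∸ j <_) (m+n∸n≡m r r) (∸-monoʳ-< r<j j≤D)

-- The map on matrices, its statistics and its bijectivity.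

encodeEntries : (ℕ → ℕ → ℕ) → ℕ → ℕ → SqMatrix
encodeEntries F D r =
  let _ , T , θ , _ = encode (sides F D r) in triangular (pad θ (centre F r)) T

-- Reading the half dimension off `d` makes the map independent of the membership proof; matrices in
-- SM(n) have `d` = r + r.
toB : SqMatrix → SqMatrix
toB (d , M) = encodeEntries (entries (d , M)) d ⌊ d /2⌋

toB-even : ∀ M → toB (r + r , M) ≡ encodeEntries (entries (r + r , M)) (r + r) r
toB-even {r} M = cong (encodeEntries (entries (r + r , M)) (r + r)) (sym (n≡⌊n+n/2⌋ r))

toB∈B : ∀ A → SM n A → B n (toB A)
toB∈B A A∈SM with r , M , refl , inSM ← SM⇒InSM A A∈SM
  with size≡n ← InSM.size≡n inSM | valid ← InSM.valid inSM | eq ← toB-even {r} M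
  with _ , T , θ , e ← encode (sides (entries A) (r + r) r) =
  subst₂ B (trans (cong₂ _+_ (sum-pad θ _) (Encodes-sum e)) size≡n) (sym eq)
    (triangular∈B _ T (nonzeroRows e _ valid))

rowSum-toB : ∀ A → SM n A → ∀ j → IsCenter A j → rowSum (toB A) (first (toB A)) ≡ colSum A j
rowSum-toB A A∈SM j (r′ , dim≡ , j≡) with r , M , refl , inSM ← SM⇒InSM A A∈SM with eq ← toB-even {r} M
  with _ , T , θ , e ← encode (sides (entries A) (r + r) r) = begin
    rowSum (toB A) (first (toB A))           ≡⟨ cong (λ Z → rowSum Z (first Z)) eq ⟩
    sum (pad θ (centre F r))                 ≡⟨ sum-pad θ (centre F r) ⟩
    sum (centre F r)                         ≡⟨ sum-segment (suc r) (λ i → F i r) ⟩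
    ∑ (suc r) (λ i → F i r)                  ≡⟨ sym (left-∑ (InSM.super inSM) ≤-refl) ⟩
    ∑ (dim A) (λ i → F i r)                  ≡⟨ cong (λ k → ∑ (dim A) (λ i → F i k)) r≡j ⟩
    ∑ (dim A) (λ i → F i (toℕ j))            ≡⟨ sym (colSum-∑ A j) ⟩
    colSum A j                               ∎
  where
  open ≡-Reasoning
  F = entries A
  -- `IsCenter` carries its own half dimension, which the dimension of `A` determines.
  r≡r′ : r ≡ r′
  r≡r′ = trans (n≡⌊n+n/2⌋ r) (trans (cong ⌊_/2⌋ (halves {r′} dim≡)) (sym (n≡⌊n+n/2⌋ r′)))
  r≡j : r ≡ toℕ j
  r≡j = suc-injective (trans (cong suc r≡r′) (trans (+-comm 1 r′) (sym j≡)))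

colSum-toB : ∀ A → SM n A → colSum (toB A) (last (toB A)) ≡ rowSum A (first A)
colSum-toB A A∈SM with r , M , refl , inSM ← SM⇒InSM A A∈SM with eq ← toB-even {r} M
  with _ , T , θ , e ← encode (sides (entries A) (r + r) r) =
  trans (cong (λ Z → colSum Z (last Z)) eq)
    (trans (lastColumn-toRows (pad θ c ∷ T))
      (trans (cong₂ _+_ (final-pad θ c) (Encodes-finals e))
        (trans (sym (topRow-∑ (InSM.super inSM))) (sym (rowSum-∑ A)))))
  where c = centre (entries A) _

,-injectiveʳ-SqMatrix : ∀ {d M N} → _≡_ {A = SqMatrix} (d , M) (d , N) → M ≡ N
,-injectiveʳ-SqMatrix refl = refl

triangular-injective : ∀ {v : Vec ℕ (suc m)} {T} {w : Vec ℕ (suc m′)} {U} → triangular v T ≡ triangular w U →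
  _≡_ {A = Σ[ m ∈ ℕ ] Vec ℕ (suc m) × Triangle m} (m , v , T) (m′ , w , U)
triangular-injective e with refl ← cong proj₁ e
  with refl ← toRows-injective (,-injectiveʳ-SqMatrix e) = refl

-- Equal images have the same first row, which is the padded centre, and the same triangle below it.
-- So `Encodes-injective` starts from the centres, and the centres agree once the paddings do.
toB-injective : ∀ A A′ → SM n A → SM n A′ → toB A ≡ toB A′ → A ≡ A′
toB-injective A A′ p p′ eq
  with r , M , refl , q ← SM⇒InSM A p | r′ , M′ , refl , q′ ← SM⇒InSM A′ p′
  with eq′ ← trans (sym (toB-even {r} M)) (trans eq (toB-even {r′} M′))
  with v ← InSM.valid q | v′ ← InSM.valid q′
  with S ← sides (entries A) (r + r) r in S≡ | S′ ← sides (entries A′) (r′ + r′) r′ in S′≡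
  with m , T , θ , e ← encode S | m′ , T′ , θ′ , e′ ← encode S′
  with c ← centre (entries A) r in c≡ | c′ ← centre (entries A′) r′ in c′≡
  with w ← pad θ c in w≡ | w′ ← pad θ′ c′ in w′≡
  with refl ← triangular-injective {v = w} {T} {w′} {T′} eq′
  with refl ← Encodes-injective e e′ c c′ v v′ (trans w≡ (sym w′≡)) refl
  with refl ← pad-injective θ (trans w≡ (sym w′≡)) =
  entries-injective {r} (InSM.super q) (InSM.super q′) (trans c≡ (sym c′≡)) (trans S≡ (sym S′≡))

-- Decoding starts with the first row as running sum. The assembled matrix maps back to `Z` because
-- `encode` can only return the encoding found by decoding.
toB-surjective : ∀ Z → B n Z → Σ[ A ∈ SqMatrix ] SM n A × toB A ≡ Z
toB-surjective Z Z∈B@(_ , size≡n , _)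
  with m , w , T , refl , nz ← B⇒triangular Z Z∈B
  with r , S , θ , c , e , refl , v ← Encodes-surjective w T nz =
  assembled c S , A∈SM , eq
  where
  size≡ : sum c + sumSides S ≡ _
  size≡ = trans (sym (cong₂ _+_ (sum-pad θ c) (Encodes-sum e)))
                (trans (sym (sum-toRows (pad θ c ∷ T))) size≡n)
  A∈SM = InSM⇒SM {r = r} (subst (λ n → InSM n r (entries (assembled c S))) size≡ (InSM-assembled c S v))
  eq : toB (assembled c S) ≡ triangular (pad θ c) T
  eq = trans (toB-even {r} (proj₂ (assembled c S)))
    (trans (cong₂ (λ c S → let _ , T , θ , _ = encode S in triangular (pad θ c) T)
                  (centre-assembled c S) (sides-assembled c S))
           (cong (λ { (_ , T , θ) → triangular (pad θ c) T })
                 (Encodes-functional (proj₂ (proj₂ (proj₂ (encode S)))) e)))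

-- The bijection and its restrictions.

β : ∀ n → Bijection ⟦ SM n ⟧ ⟦ B n ⟧
β n = record
  { to        = λ (A , A∈SM) → toB A , toB∈B A A∈SM
  ; cong      = cong toB
  ; bijective = (λ { {A , p} {A′ , p′} → toB-injective A A′ p p′ })
              , λ (Z , Z∈B) → let A , A∈SM , eq = toB-surjective Z Z∈B in
                  (A , A∈SM) , λ z≡A → trans (cong toB z≡A) eq
  }

-- The last two hypotheses make `P′` the preimage of `Q′`, so the underlying map of `f` serves
-- unchanged.
restrict : ∀ {P Q P′ Q′} (f : Bijection ⟦ P ⟧ ⟦ Q ⟧) →
           (∀ A → P′ A → P A) → (∀ Z → Q′ Z → Q Z) →
           (∀ A (p : P A) → P′ A → Q′ (proj₁ (Bijection.to f (A , p)))) →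
           (∀ A (p : P A) → Q′ (proj₁ (Bijection.to f (A , p))) → P′ A) →
           RestrictsTo f P′ Q′
restrict {P′ = P′} {Q′} f P′⊆P Q′⊆Q fwd bwd =
  record
    { to        = λ (A , p) → _ , fwd A (P′⊆P A p) p
    ; cong      = f.cong
    ; bijective = f.injective , λ (Z , q) →
        let (A , p) , h = f.surjective (Z , Q′⊆Q Z q) in
        (A , bwd A p (subst Q′ (sym (h refl)) q)) , h
    }
  , λ _ _ → f.cong
  where module f = Bijection f

theorem2p4 : ∀ (n : ℕ) → 1 ≤ n →
    Σ[ β ∈ Bijection ⟦ SM n ⟧ ⟦ B n ⟧ ]
    (∀ (k p : ℕ) → RestrictsTo β (SM′ n k p) (B′ n k p))
theorem2p4 n _ = β n , λ k p → restrict (β n) (λ _ → proj₁) (λ _ → proj₁)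
  -- The centre column becomes the first row, and the first row becomes the last column.
  (λ { A A∈SM (_ , row≡k , j , isCenter , col≡p) →
       toB∈B A A∈SM , trans (rowSum-toB A A∈SM j isCenter) col≡p , trans (colSum-toB A A∈SM) row≡k })
  (λ { A A∈SM@(r , _ , _ , dim≡ , _) (_ , row≡p , col≡k) →
       let j , isCenter = centreColumn A r dim≡ in
       A∈SM , trans (sym (colSum-toB A A∈SM)) col≡k
            , j , isCenter , trans (sym (rowSum-toB A A∈SM j isCenter)) row≡p })
  where
  centreColumn : ∀ A r → dim A ≡ 2 * r + 1 → Σ[ j ∈ Index A ] IsCenter A j
  centreColumn A@(d , _) r dim≡ with refl ← halves {r} dim≡ =
    fromℕ< r<d , r , dim≡ , trans (cong suc (toℕ-fromℕ< r<d)) (+-comm 1 r)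
    where
    r<d : r < suc (r + r)
    r<d = s≤s (m≤m+n r r)
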